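{- Let $n$ and $m$ be non-negative integers. The number of partitions of $n$ with no two consecutive integers as parts (i.e. there is no integer $k$ such that both $k$ and $k+1$ occur as parts), with all parts $\geq 2$, and with exactly $m$ odd parts, is equal to the number of partitions of $n$ into parts congruent to $0,2,3$ or $4$ modulo $6$ with exactly $m$ odd parts.
   Context: A partition is a finite non-increasing sequence of positive integers, called its parts; it is a partition of $n$ if its parts sum to $n$. The empty sequence is the unique partition of $0$. Parts may be repeated, and the number of odd parts is counted with multiplicity. -}

module Defs where

open import Data.List using (List; []; _∷_; length; sum; filter)
open import Data.List.Membership.Propositional using (_∈_)
open import Data.List.Relation.Binary.BagAndSetEquality using (∼bag⇒↭)
open import Data.List.Membership.Propositional.Properties.WithK using (unique∧set⇒bag)
open import Data.List.Relation.Binary.Permutation.Propositional.Properties using (↭-length)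
open import Data.List.Relation.Unary.All using (All)
open import Data.List.Relation.Unary.Linked using (Linked)
open import Data.List.Relation.Unary.Unique.Propositional using (Unique)
open import Data.Nat using (ℕ; suc; _≥_; _>_; _%_; _≟_)
open import Data.Product using (_×_; ∃-syntax)
open import Function using (_⇔_; mk⇔; Equivalence)
open import Relation.Binary.PropositionalEquality using (_≡_; trans; sym)
open import Relation.Nullary using (¬_)

record IsPartition (n : ℕ) (λs : List ℕ) : Set where
  field
    nonIncreasing : Linked _≥_ λs
    positive      : All (_> 0) λs
    sums          : sum λs ≡ n

oddParts : List ℕ → ℕ
oddParts λs = length (filter (λ p → p % 2 ≟ 1) λs)

NoConsecutiveParts : List ℕ → Set
NoConsecutiveParts λs = ¬ (∃[ k ] (k ∈ λs × suc k ∈ λs))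

record GapPartition (n m : ℕ) (λs : List ℕ) : Set where
  field
    isPartition   : IsPartition n λs
    noConsecutive : NoConsecutiveParts λs
    parts≥2       : All (_≥ 2) λs
    oddCount      : oddParts λs ≡ m

record CongruencePartition (n m : ℕ) (λs : List ℕ) : Set where
  field
    isPartition : IsPartition n λs
    residues    : All (λ p → p % 6 ∈ 0 ∷ 2 ∷ 3 ∷ 4 ∷ []) λs
    oddCount    : oddParts λs ≡ m

-- "The number of x with P x is k": some duplicate-free list of length k
-- contains exactly the x satisfying P.
record NumberOf {A : Set} (P : A → Set) (k : ℕ) : Set where
  field
    elements : List A
    unique   : Unique elements
    exact    : ∀ x → x ∈ elements ⇔ P x
    size     : length elements ≡ k

-- The number in NumberOf is determined by P, so two predicates sharing a
-- number k have equal counts.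
numberOf-unique : ∀ {A : Set} {P : A → Set} {j k : ℕ} →
                  NumberOf P j → NumberOf P k → j ≡ k
numberOf-unique a b =
  trans (sym (size a)) (trans (↭-length (∼bag⇒↭ bag)) (size b))
  where
  open NumberOf
  open Equivalence
  bag = unique∧set⇒bag (unique a) (unique b)
          (λ {x} → mk⇔ (λ i → from (exact b x) (to (exact a x) i))
                       (λ i → from (exact a x) (to (exact b x) i)))

{-# OPTIONS --safe #-}
-- Write a gap partition as λ = 2ν* + 3δ*, where * is conjugation: consecutive
-- differences of λ (the last part included) are the integers 2a + 3b with
-- b ≤ 1, that is, all integers except 1, and a, b are multiplicities in ν and
-- δ.  So ν is arbitrary and δ has distinct parts, and the number of odd parts
-- of λ is the alternating sum of δ.  Sylvester's bijection, which peels hooks,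
-- turns δ into a partition of the same size into odd parts whose number is the
-- alternating sum of δ.  Tripling these odd parts and doubling the parts of ν
-- gives exactly the parts congruent to 0, 2, 3, 4 modulo 6.
--
-- Encoding: ν and δ are lists of the parts minus one, and the odd parts 2a + 1
-- are recorded by the list c of the numbers a.
module Submission where

open import Defs
open import Data.Empty using (⊥)
open import Data.List using (List; []; _∷_; _++_; length; filter; map; replicate; upTo; cartesianProductWith; deduplicate)
open import Data.List.Membership.DecPropositional using (_∈?_)
open import Data.List.Membership.Propositional using (_∈_)
open import Data.List.Membership.Propositional.Properties
  using (∈-filter⁺; ∈-filter⁻; ∈-deduplicate⁺; ∈-cartesianProductWith⁺; ∈-upTo⁺)
open import Data.List.Properties using (≡-dec; ∷-injectiveˡ; ∷-injectiveʳ; length-map; length-replicate; length-++)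
open import Data.List.Relation.Binary.Pointwise using (Pointwise; []; _∷_; Pointwise-length)
open import Data.List.Relation.Unary.All as All using (All; []; _∷_; all?)
open import Data.List.Relation.Unary.AllPairs as AllPairs using (AllPairs; []; _∷_)
open import Data.List.Relation.Unary.Any using (here; there)
open import Data.List.Relation.Unary.Linked using (Linked; linked?; []; [-]; _∷_)
open import Data.List.Relation.Unary.Linked.Properties using (Linked⇒AllPairs; AllPairs⇒Linked)
open import Data.List.Relation.Unary.Unique.DecPropositional.Properties using (deduplicate-!)
open import Data.List.Relation.Unary.Unique.Propositional using (Unique)
open import Data.List.Relation.Unary.Unique.Propositional.Properties using (filter⁺)
open import Data.Nat using (ℕ; zero; suc; _+_; _*_; _∸_; _≤_; _<_; _≥_; _>_; _%_; _/_; _≟_; _≥?_; _>?_; z≤n; s≤s)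
open import Data.Nat.DivMod using ([m+kn]%n≡m%n; m*n%n≡0; m≡m%n+[m/n]*n; m%n<n)
open import Data.Nat.ListAction using (sum)
open import Data.Nat.Properties
open import Data.Nat.Tactic.RingSolver using (solve-∀)
open import Data.Product using (_×_; _,_; proj₁; proj₂; ∃-syntax)
open import Data.Sum using (_⊎_; inj₁; inj₂)
open import Function using (_∘_; mk⇔; Equivalence)
open import Relation.Binary.PropositionalEquality
  using (_≡_; _≢_; refl; sym; trans; cong; cong₂; subst; module ≡-Reasoning)
open import Relation.Nullary using (¬_; contradiction)
open import Relation.Nullary.Decidable using (map′; _×-dec_)
open import Relation.Unary using (Decidable)

-- Transfer of a count along a bijective relation.

module _ {A B : Set} {P : A → Set} {Q : B → Set} (R : A → B → Set)
  (total      : ∀ {a} → P a → ∃[ b ] (Q b × R a b))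
  (onto       : ∀ {b} → Q b → ∃[ a ] (P a × R a b))
  (functional : ∀ {a b b′} → R a b → R a b′ → b ≡ b′)
  (injective  : ∀ {a a′ b} → P a → P a′ → R a b → R a′ b → a ≡ a′)
  where

  private
    S : A → B → Set
    S a b = P a × Q b × R a b

    image : ∀ {as} → (∀ {a} → a ∈ as → P a) → ∃[ bs ] Pointwise S as bs
    image {[]}     p = [] , []
    image {a ∷ as} p with total (p (here refl)) | image (p ∘ there)
    ... | b , q , r | bs , rs = b ∷ bs , (p (here refl) , q , r) ∷ rs

    preimage-∈ : ∀ {as bs b} → Pointwise S as bs → b ∈ bs → ∃[ a ] (a ∈ as × S a b)
    preimage-∈ (s ∷ ss) (here refl) = _ , here refl , s
    preimage-∈ (s ∷ ss) (there i) with preimage-∈ ss i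
    ... | a , j , t = a , there j , t

    image-∈ : ∀ {as bs a} → Pointwise S as bs → a ∈ as → ∃[ b ] (b ∈ bs × S a b)
    image-∈ (s ∷ ss) (here refl) = _ , here refl , s
    image-∈ (s ∷ ss) (there i) with image-∈ ss i
    ... | b , j , t = b , there j , t

    image-unique : ∀ {as bs} → Pointwise S as bs → Unique as → Unique bs
    image-unique []                []       = []
    image-unique ((p , q , r) ∷ ss) (a∉ ∷ u) = All.tabulate fresh ∷ image-unique ss u
      where
      fresh : ∀ {b} → b ∈ _ → _ ≢ b
      fresh i refl with preimage-∈ ss i
      ... | a , j , p′ , _ , r′ = All.lookup a∉ j (injective p p′ r r′)

  -- Totality replaces each element of the list for `P` by a partner. Injectivity keeps the new list
  -- duplicate-free; `onto` together with `functional` shows that it exhausts `Q`.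
  numberOf-transfer : ∀ {k} → NumberOf P k → NumberOf Q k
  numberOf-transfer N = record
    { elements = bs
    ; unique   = image-unique ss (NumberOf.unique N)
    ; exact    = λ b → mk⇔ (λ i → proj₁ (proj₂ (proj₂ (proj₂ (preimage-∈ ss i))))) back
    ; size     = trans (sym (Pointwise-length ss)) (NumberOf.size N)
    }
    where
    open Equivalence
    im = image (λ {a} → to (NumberOf.exact N a))
    bs = proj₁ im
    ss = proj₂ im
    back : ∀ {b} → Q b → b ∈ bs
    back q with onto q
    ... | a , p , r with image-∈ ss (from (NumberOf.exact N a) p)
    ... | b′ , i , _ , _ , r′ with functional r′ r
    ... | refl = i

-- A finite search space for partitions.

boundedLists : ℕ → ℕ → List (List ℕ)
boundedLists n zero    = [] ∷ []
boundedLists n (suc l) = [] ∷ cartesianProductWith _∷_ (upTo (suc n)) (boundedLists n l)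

-- Entries are positive, so the sum bounds both their size and their number. The second bound drives
-- the recursion: each entry uses up at least one unit of `l`.
∈-boundedLists : ∀ {n} l {xs} → All (_> 0) xs → sum xs ≤ n → sum xs ≤ l → xs ∈ boundedLists n l
∈-boundedLists zero    []           _   _   = here refl
∈-boundedLists (suc l) []           _   _   = here refl
∈-boundedLists zero    {suc x ∷ xs} (_ ∷ ps) _ ()
∈-boundedLists (suc l) {suc x ∷ xs} (_ ∷ ps) s≤n (s≤s s≤l) =
  there (∈-cartesianProductWith⁺ _∷_ (∈-upTo⁺ (s≤s (m+n≤o⇒m≤o (suc x) s≤n)))
    (∈-boundedLists l ps (m+n≤o⇒n≤o (suc x) s≤n) (m+n≤o⇒n≤o x s≤l)))

isPartition? : ∀ n → Decidable (IsPartition n)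
isPartition? n λs = map′
  (λ (d , p , s) → record { nonIncreasing = d ; positive = p ; sums = s })
  (λ π → let open IsPartition π in nonIncreasing , positive , sums)
  (linked? _≥?_ λs ×-dec all? (_>? 0) λs ×-dec sum λs ≟ n)

congruencePartition? : ∀ n m → Decidable (CongruencePartition n m)
congruencePartition? n m λs = map′
  (λ (π , r , o) → record { isPartition = π ; residues = r ; oddCount = o })
  (λ π → let open CongruencePartition π in isPartition , residues , oddCount)
  (isPartition? n λs ×-dec all? (λ p → _∈?_ _≟_ (p % 6) _) λs ×-dec oddParts λs ≟ m)

numberOfCongruencePartitions : ∀ n m → ∃[ k ] NumberOf (CongruencePartition n m) k
numberOfCongruencePartitions n m = _ , record
  { elements = filter P? candidates
  ; unique   = filter⁺ P? (deduplicate-! _≟ₗ_ (boundedLists n n))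
  ; exact    = λ xs → mk⇔ (proj₂ ∘ ∈-filter⁻ P? {xs = candidates})
                 (λ p → ∈-filter⁺ P? (∈-deduplicate⁺ _≟ₗ_ (bounded p)) p)
  ; size     = refl
  }
  where
  _≟ₗ_ = ≡-dec _≟_
  P? = congruencePartition? n m
  candidates = deduplicate _≟ₗ_ (boundedLists n n)
  bounded : ∀ {xs} → CongruencePartition n m xs → xs ∈ boundedLists n n
  bounded p = ∈-boundedLists n positive (≤-reflexive sums) (≤-reflexive sums)
    where open IsPartition (CongruencePartition.isPartition p)

-- Adding and removing the first column of a Young diagram.

Decreasing StrictlyDecreasing : List ℕ → Set
Decreasing         = AllPairs _≥_
StrictlyDecreasing = AllPairs _>_

-- On parts minus one, this prepends a column of length `length c + z` to the Young diagram: 0 codes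
-- a new part 1. The conjugate gains that length as its new largest part, exceeding the next one by
-- `z`.
raise : List ℕ → ℕ → List ℕ
raise c z = map suc c ++ replicate z 0

length-raise : ∀ c z → length (raise c z) ≡ length c + z
length-raise c z = trans (length-++ (map suc c)) (cong₂ _+_ (length-map suc c) (length-replicate z))

sum-raise : ∀ c z → sum (raise c z) ≡ length c + sum c
sum-raise []      zero    = refl
sum-raise []      (suc z) = sum-raise [] z
sum-raise (x ∷ c) z       = cong suc (trans (cong (x +_) (sum-raise c z)) (swap x (length c) (sum c)))
  where
  swap : ∀ x l s → x + (l + s) ≡ l + (x + s)
  swap = solve-∀

-- Entries coming from `c` are successors and the padding is zero, so the boundary between them can
-- be read off.
raise-injective : ∀ c c′ {z z′} → raise c z ≡ raise c′ z′ → c ≡ c′ × z ≡ z′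
raise-injective []      []       {zero}  {zero}   eq = refl , refl
raise-injective []      []       {suc z} {suc z′} eq with raise-injective [] [] (∷-injectiveʳ eq)
... | _ , refl = refl , refl
raise-injective []      (_ ∷ _)  {zero}  ()
raise-injective []      (_ ∷ _)  {suc z} ()
raise-injective (_ ∷ _) []       {z′ = zero} ()
raise-injective (_ ∷ _) []       {z′ = suc _} ()
raise-injective (x ∷ c) (y ∷ c′) eq with ∷-injectiveˡ eq | raise-injective c c′ (∷-injectiveʳ eq)
... | refl | refl , refl = refl , refl

All-raise⁺ : ∀ {P : ℕ → Set} {c} z → All (P ∘ suc) c → P 0 → All P (raise c z)
All-raise⁺ zero    []       p = []
All-raise⁺ (suc z) []       p = p ∷ All-raise⁺ z [] p
All-raise⁺ z       (q ∷ qs) p = q ∷ All-raise⁺ z qs p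

All-raise⁻ : ∀ {P : ℕ → Set} c {z} → All P (raise c z) → All (P ∘ suc) c
All-raise⁻ []      _        = []
All-raise⁻ (x ∷ c) (p ∷ ps) = p ∷ All-raise⁻ c ps

decreasing-raise⁺ : ∀ {c} z → Decreasing c → Decreasing (raise c z)
decreasing-raise⁺ zero    []       = []
decreasing-raise⁺ (suc z) []       = All-raise⁺ z [] z≤n ∷ decreasing-raise⁺ z []
decreasing-raise⁺ z       (p ∷ ps) = All-raise⁺ z (All.map s≤s p) z≤n ∷ decreasing-raise⁺ z ps

strictlyDecreasing-raise⁺ : ∀ {c z} → z ≤ 1 → StrictlyDecreasing c → StrictlyDecreasing (raise c z)
strictlyDecreasing-raise⁺ z≤n       []       = []
strictlyDecreasing-raise⁺ (s≤s z≤n) []       = [] ∷ []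
strictlyDecreasing-raise⁺ {z = z} le (p ∷ ps) =
  All-raise⁺ z (All.map s≤s p) (s≤s z≤n) ∷ strictlyDecreasing-raise⁺ le ps

decreasing-raise⁻ : ∀ c {z} → Decreasing (raise c z) → Decreasing c
decreasing-raise⁻ []      _        = []
decreasing-raise⁻ (x ∷ c) (p ∷ ps) = All.map ≤-pred (All-raise⁻ c p) ∷ decreasing-raise⁻ c ps

-- Distinct parts leave room for at most one part 1; this is the source of the bound on the
-- coefficient of 3.
strictlyDecreasing-raise⁻ : ∀ c {z} → StrictlyDecreasing (raise c z) → StrictlyDecreasing c × z ≤ 1
strictlyDecreasing-raise⁻ [] {zero}        _                = [] , z≤n
strictlyDecreasing-raise⁻ [] {suc zero}    _                = [] , s≤s z≤n
strictlyDecreasing-raise⁻ [] {suc (suc z)} ((() ∷ _) ∷ _)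
strictlyDecreasing-raise⁻ (x ∷ c) (p ∷ ps) with strictlyDecreasing-raise⁻ c ps
... | qs , le = All.map ≤-pred (All-raise⁻ c p) ∷ qs , le

lower : ∀ {xs} → Decreasing xs → ∃[ c ] ∃[ z ] (xs ≡ raise c z × Decreasing c)
lower []                     = [] , 0 , refl , []
lower {suc x ∷ xs} (p ∷ ps) with lower ps
... | c , z , refl , d = x ∷ c , z , refl , All.map ≤-pred (All-raise⁻ c p) ∷ d
lower {zero ∷ xs} (p ∷ ps) with lower ps
... | []    , z , refl , d = [] , suc z , refl , []
-- A nonempty `c` would place the entry `suc y` after 0, against the order.
... | y ∷ c , z , refl , d with () ← All.head p

-- The size of the partition whose parts minus one are listed by c.
size : List ℕ → ℕ
size c = sum c + length c

size-raise : ∀ c z → size (raise c z) ≡ size c + length (raise c z)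
size-raise c z = cong (_+ length (raise c z)) (trans (sum-raise c z) (+-comm (length c) (sum c)))

-- This is the alternating sum of the parts themselves: the shift by one cancels in each pair and
-- survives only in an unpaired last part. On decreasing lists the truncated subtraction is exact.
alternatingSum : List ℕ → ℕ
alternatingSum []            = 0
alternatingSum (d ∷ [])      = suc d
alternatingSum (d ∷ d′ ∷ ds) = (d ∸ d′) + alternatingSum ds

-- A new column adds one to every part, which cancels in pairs; only its parity is left.
alternatingSum-raise : ∀ δ {b} → b ≤ 1 →
  alternatingSum (raise δ b) ≡ length (raise δ b) % 2 + alternatingSum δ
alternatingSum-raise []           z≤n       = refl
alternatingSum-raise []           (s≤s z≤n) = refl
alternatingSum-raise (d ∷ [])     z≤n       = refl
alternatingSum-raise (d ∷ [])     (s≤s z≤n) = +-identityʳ (suc d)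
alternatingSum-raise (d ∷ d′ ∷ δ) {b} b≤1   =
  trans (cong ((d ∸ d′) +_) (alternatingSum-raise δ b≤1))
    (swap (d ∸ d′) (length (raise δ b) % 2) (alternatingSum δ))
  where
  swap : ∀ x l s → x + (l + s) ≡ l + (x + s)
  swap = solve-∀

oddParts-∷ : ∀ p ps → oddParts (p ∷ ps) ≡ p % 2 + oddParts ps
oddParts-∷ p ps with p % 2 | m%n<n p 2
... | zero        | _ = refl
... | suc zero    | _ = refl
... | suc (suc _) | s≤s (s≤s ())

-- Gap partitions as combinations of two conjugates

-- The number of parts is the largest part of the conjugate, so this is the largest part of 2ν* +
-- 3δ*.
height : List ℕ → List ℕ → ℕ
height ν δ = 2 * length ν + 3 * length δ

height-raise : ∀ ν a δ b → height (raise ν a) (raise δ b) ≡ height ν δ + (2 * a + 3 * b)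
height-raise ν a δ b = trans
  (cong₂ (λ l k → 2 * l + 3 * k) (length-raise ν a) (length-raise δ b))
  (rearrange (length ν) a (length δ) b)
  where
  rearrange : ∀ l a k b → 2 * (l + a) + 3 * (k + b) ≡ (2 * l + 3 * k) + (2 * a + 3 * b)
  rearrange = solve-∀

-- λs = 2ν* + 3δ*
data Conjugates : (λs ν δ : List ℕ) → Set where
  []   : Conjugates [] [] []
  cons : ∀ {x λs ν δ ν′ δ′} a b → b ≤ 1 → ν′ ≡ raise ν a → δ′ ≡ raise δ b →
         x ≡ height ν′ δ′ → 0 < x → Conjugates λs ν δ → Conjugates (x ∷ λs) ν′ δ′

-- The default 0 makes the last part of a partition a difference like the others.
headOrZero : List ℕ → ℕ
headOrZero []      = 0
headOrZero (x ∷ _) = x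

conjugates-head : ∀ {λs ν δ} → Conjugates λs ν δ → headOrZero λs ≡ height ν δ
conjugates-head []                       = refl
conjugates-head (cons _ _ _ _ _ eq _ _) = eq

conjugates-decreasing : ∀ {λs ν δ} → Conjugates λs ν δ → Decreasing ν
conjugates-decreasing []                              = []
conjugates-decreasing (cons a _ _ refl _ _ _ r) = decreasing-raise⁺ a (conjugates-decreasing r)

conjugates-strictlyDecreasing : ∀ {λs ν δ} → Conjugates λs ν δ → StrictlyDecreasing δ
conjugates-strictlyDecreasing []                         = []
conjugates-strictlyDecreasing (cons _ _ le _ refl _ _ r) =
  strictlyDecreasing-raise⁺ le (conjugates-strictlyDecreasing r)

conjugates-sum : ∀ {λs ν δ} → Conjugates λs ν δ → sum λs ≡ 2 * size ν + 3 * size δ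
conjugates-sum [] = refl
conjugates-sum (cons {λs = λs} {ν} {δ} a b _ refl refl refl _ r) = begin
  height ν′ δ′ + sum λs
    ≡⟨ cong (height ν′ δ′ +_) (conjugates-sum r) ⟩
  height ν′ δ′ + (2 * size ν + 3 * size δ)
    ≡⟨ rearrange (length ν′) (length δ′) (size ν) (size δ) ⟩
  2 * (size ν + length ν′) + 3 * (size δ + length δ′)
    ≡⟨ cong₂ (λ s t → 2 * s + 3 * t) (size-raise ν a) (size-raise δ b) ⟨
  2 * size ν′ + 3 * size δ′ ∎
  where
  open ≡-Reasoning
  ν′ = raise ν a
  δ′ = raise δ b
  rearrange : ∀ l k s t → 2 * l + 3 * k + (2 * s + 3 * t) ≡ 2 * (s + l) + 3 * (t + k)
  rearrange = solve-∀

height-parity : ∀ ν δ → height ν δ % 2 ≡ length δ % 2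
height-parity ν δ = trans (cong (_% 2) (rearrange (length ν) (length δ)))
  ([m+kn]%n≡m%n (length δ) (length ν + length δ) 2)
  where
  rearrange : ∀ l k → 2 * l + 3 * k ≡ k + (l + k) * 2
  rearrange = solve-∀

-- Each part of λ has the parity of the corresponding column length of δ, and by
-- `alternatingSum-raise` the odd columns are what the alternating sum counts.
conjugates-oddParts : ∀ {λs ν δ} → Conjugates λs ν δ → oddParts λs ≡ alternatingSum δ
conjugates-oddParts [] = refl
conjugates-oddParts (cons {λs = λs} {ν} {δ} a b le refl refl refl _ r) = begin
  oddParts (x ∷ λs)                              ≡⟨ oddParts-∷ x λs ⟩
  x % 2 + oddParts λs                            ≡⟨ cong₂ _+_ (height-parity (raise ν a) (raise δ b)) (conjugates-oddParts r) ⟩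
  length (raise δ b) % 2 + alternatingSum δ      ≡⟨ alternatingSum-raise δ le ⟨
  alternatingSum (raise δ b)                     ∎
  where
  open ≡-Reasoning
  x = height (raise ν a) (raise δ b)

-- The parity of the value decides between `b = 0` and `b = 1`; then `a` follows by cancellation.
2a+3b-injective : ∀ a a′ {b b′} → b ≤ 1 → b′ ≤ 1 → 2 * a + 3 * b ≡ 2 * a′ + 3 * b′ → a ≡ a′ × b ≡ b′
2a+3b-injective a a′ z≤n z≤n eq =
  *-cancelˡ-≡ a a′ 2 (+-cancelʳ-≡ 0 (2 * a) (2 * a′) eq) , refl
2a+3b-injective a a′ (s≤s z≤n) (s≤s z≤n) eq =
  *-cancelˡ-≡ a a′ 2 (+-cancelʳ-≡ 3 (2 * a) (2 * a′) eq) , refl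
2a+3b-injective a a′ z≤n (s≤s z≤n) eq =
  contradiction (trans (sym (+-identityʳ (2 * a))) (trans eq (odd a′))) (even≢odd a (suc a′))
  where
  odd : ∀ a → 2 * a + 3 ≡ suc (2 * suc a)
  odd = solve-∀
2a+3b-injective a a′ (s≤s z≤n) z≤n eq with 2a+3b-injective a′ a z≤n (s≤s z≤n) (sym eq)
... | _ , ()

2a+3b-surjective : ∀ d → d ≢ 1 → ∃[ a ] ∃[ b ] (b ≤ 1 × d ≡ 2 * a + 3 * b)
2a+3b-surjective 0 _  = 0 , 0 , z≤n , refl
2a+3b-surjective 1 ≢1 = contradiction refl ≢1
2a+3b-surjective 2 _  = 1 , 0 , z≤n , refl
2a+3b-surjective 3 _  = 0 , 1 , s≤s z≤n , refl
-- Requiring `d` to be at least 2 keeps the descent by two from landing on 1.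
2a+3b-surjective (suc (suc d@(suc (suc _)))) _ with 2a+3b-surjective d (λ ())
... | a , b , le , eq = suc a , b , le , trans (cong (2 +_) eq) (step a b)
  where
  step : ∀ a b → 2 + (2 * a + 3 * b) ≡ 2 * suc a + 3 * b
  step = solve-∀

-- Serves twice: applied to a difference of neighbours it excludes consecutive parts, applied to a
-- whole part it excludes the part 1.
2a+3b≢1 : ∀ a b → 2 * a + 3 * b ≢ 1
2a+3b≢1 zero    zero    ()
2a+3b≢1 zero    (suc b) eq with () ← trans (sym eq) (*-suc 3 b)
2a+3b≢1 (suc a) b       eq with () ← trans (sym eq) (cong (_+ 3 * b) (*-suc 2 a))

-- Once the tails agree, `x` minus `height ν δ` is `2 * a + 3 * b`, which determines both
-- multiplicities.
conjugates-functional : ∀ {λs ν δ ν′ δ′} → Conjugates λs ν δ → Conjugates λs ν′ δ′ → ν ≡ ν′ × δ ≡ δ′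
conjugates-functional [] [] = refl , refl
conjugates-functional (cons {ν = ν} {δ} a b le refl refl eq _ r) (cons a′ b′ le′ refl refl eq′ _ r′)
  with conjugates-functional r r′
... | refl , refl
  with 2a+3b-injective a a′ le le′ (+-cancelˡ-≡ (height ν δ) _ _
         (trans (sym (height-raise ν a δ b)) (trans (sym eq) (trans eq′ (height-raise ν a′ δ b′)))))
... | refl , refl = refl , refl

conjugates-injective : ∀ {λs λs′ ν δ} → Conjugates λs ν δ → Conjugates λs′ ν δ → λs ≡ λs′
conjugates-injective [] [] = refl
-- Empty ν and δ force `x = 0`, which `0 < x` excludes; hence no trailing zeros in λ.
conjugates-injective [] (cons _ _ _ _ _ refl () _)
conjugates-injective (cons _ _ _ _ _ refl () _) []
conjugates-injective (cons {ν = ν} {δ} a b _ refl refl eq _ r) (cons {ν = ν₁} {δ₁} a′ b′ _ eqν eqδ eq′ _ r′)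
  with raise-injective ν ν₁ eqν | raise-injective δ δ₁ eqδ
... | refl , refl | refl , refl = cong₂ _∷_ (trans eq (sym eq′)) (conjugates-injective r r′)

record Gap (λs : List ℕ) : Set where
  constructor gap
  field
    nonIncreasing : Decreasing λs
    parts≥2       : All (_≥ 2) λs
    noConsecutive : NoConsecutiveParts λs

-- Builds the diagrams from the smallest part upwards. The difference to the next part is never 1:
-- between two parts because they are not consecutive, at the last part because it is at least 2.
gap⇒conjugates : ∀ {λs} → Gap λs → ∃[ ν ] ∃[ δ ] Conjugates λs ν δ
gap⇒conjugates {[]} _ = [] , [] , []
gap⇒conjugates {x ∷ λs} (gap (x≥ ∷ ds) (x≥2 ∷ ≥2s) nc)
  with gap⇒conjugates (gap ds ≥2s (λ (k , i , j) → nc (k , there i , there j)))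
... | ν , δ , r with 2a+3b-surjective (x ∸ h) (x∸h≢1 λs x≥ nc)
  where
  h = headOrZero λs
  x∸h≢1 : ∀ λs → All (x ≥_) λs → NoConsecutiveParts (x ∷ λs) → x ∸ headOrZero λs ≢ 1
  x∸h≢1 []      _          _  eq = contradiction (subst (_≥ 2) eq x≥2) 1+n≰n
  x∸h≢1 (y ∷ _) (x≥y ∷ _) nc eq = nc (y , there (here refl) , here suc-y≡x)
    where
    suc-y≡x : suc y ≡ x
    suc-y≡x = trans (cong (_+ y) (sym eq)) (m∸n+n≡m x≥y)
... | a , b , le , eq = raise ν a , raise δ b , cons a b le refl refl x≡ (≤-trans (s≤s z≤n) x≥2) r
  where
  head≤x : ∀ {λs} → All (x ≥_) λs → headOrZero λs ≤ x
  head≤x []      = z≤n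
  head≤x (p ∷ _) = p
  open ≡-Reasoning
  x≡ : x ≡ height (raise ν a) (raise δ b)
  x≡ = begin
    x                                   ≡⟨ m+[n∸m]≡n (head≤x x≥) ⟨
    headOrZero λs + (x ∸ headOrZero λs) ≡⟨ cong₂ _+_ (conjugates-head r) eq ⟩
    height ν δ + (2 * a + 3 * b)        ≡⟨ height-raise ν a δ b ⟨
    height (raise ν a) (raise δ b)      ∎

conjugates-bounded : ∀ {λs ν δ} → Conjugates λs ν δ → All (height ν δ ≥_) λs
conjugates-bounded [] = []
conjugates-bounded (cons {ν = ν} {δ} a b _ refl refl refl _ r) =
  ≤-refl ∷ All.map (λ le → ≤-trans le h≤) (conjugates-bounded r)
  where
  h≤ : height ν δ ≤ height (raise ν a) (raise δ b)
  h≤ = subst (height ν δ ≤_) (sym (height-raise ν a δ b)) (m≤m+n (height ν δ) _)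

headOrZero-∈ : ∀ {k λs} → k ∈ λs → headOrZero λs ∈ λs
headOrZero-∈ {λs = _ ∷ _} _ = here refl

conjugates⇒gap : ∀ {λs ν δ} → Conjugates λs ν δ → Gap λs
conjugates⇒gap [] = gap [] [] (λ ())
conjugates⇒gap c@(cons {x} {λs} {ν} {δ} a b _ refl refl refl 0<x r) with conjugates⇒gap r
... | gap ds ≥2s nc = gap (x≥ ∷ ds) (≥2 ∷ ≥2s) nc′
  where
  x≥ : All (x ≥_) λs
  x≥ = All.tail (conjugates-bounded c)

  ≥2 : x ≥ 2
  ≥2 = ≤∧≢⇒< 0<x (2a+3b≢1 (length (raise ν a)) (length (raise δ b)) ∘ sym)

  suc-k≡x⇒⊥ : ∀ k → suc k ≡ x → k ∈ λs → ¬ (suc k ∈ λs) → 2 * a + 3 * b ≡ x ∸ height ν δ → height ν δ ∈ λs → ⊥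
  -- The head h of `λs` lies between `k` and `x = k + 1`. If h is `k`, the difference
  -- `2 * a + 3 * b` would be 1; otherwise h is `k + 1`, and `λs` already contains a consecutive
  -- pair.
  suc-k≡x⇒⊥ k eq k∈ suc-k∉ d≡ h∈ with m≤n⇒m<n∨m≡n (All.lookup (conjugates-bounded r) k∈)
  ... | inj₂ refl = 2a+3b≢1 a b (trans d≡ (trans (cong (_∸ k) (sym eq)) (m+n∸n≡m 1 k)))
  ... | inj₁ k<h  = suc-k∉ (subst (_∈ λs) (≤-antisym (≤-trans (All.lookup x≥ h∈) (≤-reflexive (sym eq))) k<h) h∈)

  nc′ : NoConsecutiveParts (x ∷ λs)
  nc′ (k , here refl , here eq) = contradiction eq 1+n≢n
  nc′ (k , here refl , there j) = contradiction (All.lookup x≥ j) 1+n≰n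
  nc′ (k , there i   , there j) = nc (k , i , j)
  nc′ (k , there i   , here eq) = suc-k≡x⇒⊥ k eq i (λ j → nc (k , i , j))
    (sym (trans (cong (_∸ height ν δ) (height-raise ν a δ b)) (m+n∸m≡n (height ν δ) _)))
    (subst (_∈ λs) (conjugates-head r) (headOrZero-∈ i))

nonempty-or-both-empty : (ν δ : List ℕ) → (ν ≡ [] × δ ≡ []) ⊎ 0 < length ν + length δ
nonempty-or-both-empty []      []      = inj₁ (refl , refl)
nonempty-or-both-empty []      (_ ∷ _) = inj₂ (s≤s z≤n)
nonempty-or-both-empty (_ ∷ _) _       = inj₂ (s≤s z≤n)

-- Reads λ off from its largest part by removing the first columns of ν and δ together. Unless both
-- are empty this removes a cell, so the combined size can serve as fuel, and the part obtained is
-- positive.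
conjugates-total : ∀ {ν δ} → Decreasing ν → StrictlyDecreasing δ → ∃[ λs ] Conjugates λs ν δ
conjugates-total {ν} {δ} dν dδ = go (size ν + size δ) dν dδ ≤-refl
  where
  go : ∀ fuel {ν δ} → Decreasing ν → StrictlyDecreasing δ → size ν + size δ ≤ fuel → ∃[ λs ] Conjugates λs ν δ
  go fuel {ν′} {δ′} dν dδ le with nonempty-or-both-empty ν′ δ′
  ... | inj₁ (refl , refl) = [] , []
  ... | inj₂ 0<l with lower dν | lower (AllPairs.map <⇒≤ dδ)
  ... | ν , a , refl , dν₀ | δ , b , refl , _ with strictlyDecreasing-raise⁻ δ dδ
  ... | dδ₀ , b≤1 = step fuel (≤-trans size< le)
    where
    size< : size ν + size δ < size ν′ + size δ′
    size< = begin-strict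
      size ν + size δ                                 <⟨ m<m+n (size ν + size δ) 0<l ⟩
      size ν + size δ + (length ν′ + length δ′)       ≡⟨ interchange (size ν) (size δ) (length ν′) (length δ′) ⟩
      (size ν + length ν′) + (size δ + length δ′)     ≡⟨ cong₂ _+_ (size-raise ν a) (size-raise δ b) ⟨
      size ν′ + size δ′                               ∎
      where
      open ≤-Reasoning
      interchange : ∀ s t l k → s + t + (l + k) ≡ (s + l) + (t + k)
      interchange = solve-∀

    0<h : 0 < height ν′ δ′
    0<h = ≤-trans 0<l (subst (length ν′ + length δ′ ≤_) (split (length ν′) (length δ′)) (m≤m+n _ _))
      where
      split : ∀ l k → (l + k) + (l + 2 * k) ≡ 2 * l + 3 * k
      split = solve-∀

    step : ∀ fuel → size ν + size δ < fuel → ∃[ λs ] Conjugates λs ν′ δ′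
    step (suc fuel) (s≤s le₀) with go fuel dν₀ dδ₀ le₀
    ... | λs , r = _ , cons a b b≤1 refl refl refl 0<h r

-- Sylvester's bijection

-- In `pair`, the part d₁ + 1 is x + |c′| + 1, the first hook length of the
-- partition whose parts minus one are listed by x ∷ c′; `single` is the pair
-- of parts z + 1 and 0, the latter omitted.
data Hooks : (δ c : List ℕ) → Set where
  []     : Hooks [] []
  single : ∀ z → Hooks (z ∷ []) (0 ∷ raise [] z)
  pair   : ∀ {δ c c′ d₁ d₂ x} z → Hooks δ c → All (x >_) c → suc d₂ ≡ x + length c →
           d₁ ≡ suc (d₂ + z) → c′ ≡ raise c z → Hooks (d₁ ∷ d₂ ∷ δ) (x ∷ c′)

hooks-decreasing : ∀ {δ c} → Hooks δ c → Decreasing c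
hooks-decreasing []         = []
hooks-decreasing (single z) = All-raise⁺ z [] z≤n ∷ decreasing-raise⁺ z []
hooks-decreasing (pair z h x> _ _ refl) = All-raise⁺ z x> z≤n ∷ decreasing-raise⁺ z (hooks-decreasing h)

hooks-head : ∀ {d δ y c} → Hooks (d ∷ δ) (y ∷ c) → d ≡ y + length c
hooks-head (single z) = sym (length-raise [] z)
hooks-head (pair {c = c} {x = x} z _ _ eq refl refl) = begin
  suc _ + z                  ≡⟨ cong (_+ z) eq ⟩
  x + length c + z           ≡⟨ +-assoc x (length c) z ⟩
  x + (length c + z)         ≡⟨ cong (x +_) (length-raise c z) ⟨
  x + length (raise c z)     ∎
  where open ≡-Reasoning

-- Strictness between successive pairs: by `hooks-head` the next entry is `y` plus the length of the
-- tail of `c`, and `x > y`.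
hooks-linked-∷ : ∀ {δ c x d} → Hooks δ c → All (x >_) c → suc d ≡ x + length c →
                 Linked _>_ δ → Linked _>_ (d ∷ δ)
hooks-linked-∷ []                      _         _  _ = [-]
hooks-linked-∷ {_ ∷ _} {y ∷ c} {x} {d} h (x>y ∷ _) eq l = d>d′ ∷ l
  where
  d>d′ : _ < d
  d>d′ = begin-strict
    _              ≡⟨ hooks-head h ⟩
    y + length c   <⟨ +-monoˡ-< (length c) x>y ⟩
    x + length c   ≡⟨ suc-injective (trans eq (+-suc x (length c))) ⟨
    d              ∎
    where open ≤-Reasoning

hooks-linked : ∀ {δ c} → Hooks δ c → Linked _>_ δ
hooks-linked []         = []
hooks-linked (single _) = [-]
hooks-linked (pair z h x> eq refl _) = s≤s (m≤m+n _ z) ∷ hooks-linked-∷ h x> eq (hooks-linked h)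

-- The two hooks of a pair differ by `z + 1`, the number of rows the pair removes: the row `x` and
-- the `z` zero entries.
hooks-length : ∀ {δ c} → Hooks δ c → length c ≡ alternatingSum δ
hooks-length []         = refl
hooks-length (single z) = cong suc (length-raise [] z)
hooks-length (pair {δ} {c} {d₂ = d₂} z h _ _ refl refl) = begin
  suc (length (raise c z))                        ≡⟨ cong suc (length-raise c z) ⟩
  suc (length c + z)                              ≡⟨ cong suc (+-comm (length c) z) ⟩
  suc z + length c                                ≡⟨ cong₂ _+_ (sym (trans (cong (_∸ d₂) (sym (+-suc d₂ z))) (m+n∸m≡n d₂ (suc z)))) (hooks-length h) ⟩
  (suc (d₂ + z) ∸ d₂) + alternatingSum δ          ∎
  where open ≡-Reasoning

-- Split each odd part 2a + 1 into rows of a + 1 and a cells, forming two diagrams. The two parts of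
-- a pair are the first hooks of these diagrams, and removing both hooks leaves the two diagrams of
-- the shorter list `c`.
hooks-size : ∀ {δ c} → Hooks δ c → size δ ≡ sum c + size c
hooks-size []         = refl
hooks-size (single z) = begin
  z + 0 + 1                                               ≡⟨ rearrange z ⟩
  suc z                                                   ≡⟨ cong suc (length-raise [] z) ⟨
  suc (length (raise [] z))                               ≡⟨ cong (λ s → s + (s + suc (length (raise [] z)))) (sum-raise [] z) ⟨
  sum (raise [] z) + (sum (raise [] z) + suc (length (raise [] z))) ∎
  where
  open ≡-Reasoning
  rearrange : ∀ z → z + 0 + 1 ≡ suc z
  rearrange = solve-∀
hooks-size (pair {δ} {c} {d₂ = d₂} {x} z h _ eq refl refl) = begin
  suc (d₂ + z) + (d₂ + sum δ) + suc (suc (length δ))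
    ≡⟨ rearrange₁ d₂ z (sum δ) (length δ) ⟩
  suc d₂ + suc d₂ + suc z + size δ
    ≡⟨ cong₂ (λ e s → e + e + suc z + s) eq (hooks-size h) ⟩
  (x + length c) + (x + length c) + suc z + (sum c + size c)
    ≡⟨ rearrange₂ x z (sum c) (length c) ⟩
  (x + (length c + sum c)) + ((x + (length c + sum c)) + suc (length c + z))
    ≡⟨ cong₂ (λ s l → (x + s) + ((x + s) + suc l)) (sum-raise c z) (length-raise c z) ⟨
  (x + sum (raise c z)) + size (x ∷ raise c z)
    ∎
  where
  open ≡-Reasoning
  rearrange₁ : ∀ d z s l → suc (d + z) + (d + s) + suc (suc l) ≡ suc d + suc d + suc z + (s + l)
  rearrange₁ = solve-∀
  rearrange₂ : ∀ x z s l → (x + l) + (x + l) + suc z + (s + (s + l)) ≡ (x + (l + s)) + ((x + (l + s)) + suc (l + z))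
  rearrange₂ = solve-∀

-- The difference of the two leading entries gives `z`; then `d₂` and the length of `c` give `x`.
hooks-functional : ∀ {δ c c′} → Hooks δ c → Hooks δ c′ → c ≡ c′
hooks-functional []         []          = refl
hooks-functional (single z) (single .z) = refl
hooks-functional (pair {c = c} {d₂ = d₂} {x} z h _ eq refl refl) (pair {x = x′} z′ h′ _ eq′ eqd refl)
  with hooks-functional h h′ | +-cancelˡ-≡ (suc d₂) z z′ eqd
... | refl | refl = cong (_∷ raise c z) (+-cancelʳ-≡ (length c) x x′ (trans (sym eq) eq′))

hooks-injective : ∀ {δ δ′ c} → Hooks δ c → Hooks δ′ c → δ ≡ δ′
hooks-injective h h′ = inj h h′ refl
  where
  -- Two indices joined by an equation, because `raise c z` cannot be unified with another `raise`.
  inj : ∀ {δ δ′ c c′} → Hooks δ c → Hooks δ′ c′ → c ≡ c′ → δ ≡ δ′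
  inj [] [] _ = refl
  inj (single z) (single z′) eq with raise-injective [] [] (∷-injectiveʳ eq)
  ... | _ , refl = refl
  -- A pair never starts with `x = 0`: with `c` empty, `suc d₂` would be 0, and otherwise 0 would
  -- exceed an entry of `c`.
  inj (single _) (pair {c = []} _ _ _ () _ _) refl
  inj (single _) (pair {c = _ ∷ _} _ _ (() ∷ _) _ _ _) refl
  inj (pair {c = []} _ _ _ () _ _) (single _) refl
  inj (pair {c = _ ∷ _} _ _ (() ∷ _) _ _ _) (single _) refl
  inj (pair {c = c} z h _ eq refl refl) (pair {c = c₁} z′ h′ _ eq′ refl refl) eqs
    with ∷-injectiveˡ eqs | raise-injective c c₁ (∷-injectiveʳ eqs)
  ... | refl | refl , refl with inj h h′ refl | suc-injective (trans eq (sym eq′))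
  ... | refl | refl = refl

-- Solves the hook equation for the arm `x`. That `d` exceeds the first hook of δ is what makes `x`
-- exceed the head of `c`, hence all of `c`.
hooks-arm : ∀ {δ c d} → Hooks δ c → All (d >_) δ → ∃[ x ] (All (x >_) c × suc d ≡ x + length c)
hooks-arm {d = d} [] _ = suc d , [] , sym (+-identityʳ (suc d))
hooks-arm {_ ∷ _} {y ∷ c} {d} h (d>d′ ∷ _) with hooks-decreasing h
-- Here `c` is the tail after `y`, so the full length is `suc (length c)` and the two successors
-- cancel.
... | y≥ ∷ _ = d ∸ length c , y<x ∷ All.map (λ le → ≤-trans (s≤s le) y<x) y≥ , eq
  where
  y+l<d : y + length c < d
  y+l<d = subst (_< d) (hooks-head h) d>d′
  y<x : y < d ∸ length c
  y<x = m+n≤o⇒m≤o∸n (suc y) y+l<d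
  eq : suc d ≡ (d ∸ length c) + suc (length c)
  eq = sym (trans (+-suc _ (length c)) (cong suc (m∸n+n≡m (≤-trans (m≤n+m (length c) (suc y)) y+l<d))))

hooks-total : ∀ {δ} → StrictlyDecreasing δ → ∃[ c ] Hooks δ c
hooks-total []       = [] , []
hooks-total ([] ∷ []) = _ , single _
hooks-total ((d₁>d₂ ∷ _) ∷ d₂> ∷ ds) with hooks-total ds
... | c , h with hooks-arm h d₂>
... | x , x> , eq = _ , pair _ h x> eq (sym (m+[n∸m]≡n d₁>d₂)) refl

-- Removes the first row `x` and the first column of what remains. If `x` is 0, everything below is
-- 0 and the hook is `single`; otherwise it is a `pair`.
hooks-onto : ∀ {c} → Decreasing c → ∃[ δ ] Hooks δ c
hooks-onto {c} dc = go (length c) dc ≤-refl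
  where
  go : ∀ fuel {c} → Decreasing c → length c ≤ fuel → ∃[ δ ] Hooks δ c
  go fuel [] _ = [] , []
  go (suc fuel) {x ∷ xs} (x≥ ∷ ds) (s≤s le) with lower ds
  ... | c , z , refl , dc with go fuel dc (≤-trans (subst (length c ≤_) (sym (length-raise c z)) (m≤m+n _ z)) le)
  -- Raised entries are bounded by `x`, so the entries of `c` before raising are strictly below it.
  ... | δ , h = last x c (All-raise⁻ c x≥) h
    where
    last : ∀ x c {δ} → All (x >_) c → Hooks δ c → ∃[ δ ] Hooks δ (x ∷ raise c z)
    last zero    []      _        _ = _ , single z
    last zero    (_ ∷ _) (() ∷ _) _
    last (suc x) c       x>       h = _ , pair z h x> refl refl refl

-- Separating the even parts from the odd multiples of three

data Shuffle : (κ ν c : List ℕ) → Set where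
  []   : Shuffle [] [] []
  even : ∀ {κ ν c p} a → p ≡ 2 * suc a → Shuffle κ ν c → Shuffle (p ∷ κ) (a ∷ ν) c
  odd  : ∀ {κ ν c p} a → p ≡ 3 * suc (2 * a) → Shuffle κ ν c → Shuffle (p ∷ κ) ν (a ∷ c)

3[1+2a]≡1+2[1+3a] : ∀ a → 3 * suc (2 * a) ≡ suc (2 * suc (3 * a))
3[1+2a]≡1+2[1+3a] = solve-∀

even-part≢odd-part : ∀ a b → 2 * suc a ≢ 3 * suc (2 * b)
even-part≢odd-part a b eq = even≢odd (suc a) (suc (3 * b)) (trans eq (3[1+2a]≡1+2[1+3a] b))

even-part-cancel-≤ : ∀ {a b} → 2 * suc a ≤ 2 * suc b → a ≤ b
even-part-cancel-≤ = ≤-pred ∘ *-cancelˡ-≤ 2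

odd-part-cancel-≤ : ∀ {a b} → 3 * suc (2 * a) ≤ 3 * suc (2 * b) → a ≤ b
odd-part-cancel-≤ = *-cancelˡ-≤ 2 ∘ ≤-pred ∘ *-cancelˡ-≤ 3

even-part-mono-≤ : ∀ {a b} → a ≤ b → 2 * suc a ≤ 2 * suc b
even-part-mono-≤ = *-monoʳ-≤ 2 ∘ s≤s

odd-part-mono-≤ : ∀ {a b} → a ≤ b → 3 * suc (2 * a) ≤ 3 * suc (2 * b)
odd-part-mono-≤ = *-monoʳ-≤ 3 ∘ s≤s ∘ *-monoʳ-≤ 2

module _ {P : ℕ → Set} where

  All-shuffle⁺ : ∀ {κ ν c} → Shuffle κ ν c → All (λ a → P (2 * suc a)) ν →
                 All (λ a → P (3 * suc (2 * a))) c → All P κ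
  All-shuffle⁺ []              _        _        = []
  All-shuffle⁺ (even _ refl s) (p ∷ ps) qs       = p ∷ All-shuffle⁺ s ps qs
  All-shuffle⁺ (odd _ refl s)  ps       (q ∷ qs) = q ∷ All-shuffle⁺ s ps qs

  All-shuffle⁻ : ∀ {κ ν c} → Shuffle κ ν c → All P κ →
                 All (λ a → P (2 * suc a)) ν × All (λ a → P (3 * suc (2 * a))) c
  All-shuffle⁻ []              _        = [] , []
  All-shuffle⁻ (even _ refl s) (p ∷ ps) with All-shuffle⁻ s ps
  ... | es , os = p ∷ es , os
  All-shuffle⁻ (odd _ refl s)  (p ∷ ps) with All-shuffle⁻ s ps
  ... | es , os = es , p ∷ os

shuffle-decreasing : ∀ {κ ν c} → Shuffle κ ν c → Decreasing κ → Decreasing ν × Decreasing c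
shuffle-decreasing []              _        = [] , []
shuffle-decreasing (even _ refl s) (p ∷ ps) with shuffle-decreasing s ps
... | dν , dc = All.map even-part-cancel-≤ (proj₁ (All-shuffle⁻ s p)) ∷ dν , dc
shuffle-decreasing (odd _ refl s)  (p ∷ ps) with shuffle-decreasing s ps
... | dν , dc = dν , All.map odd-part-cancel-≤ (proj₂ (All-shuffle⁻ s p)) ∷ dc

-- The merge of two sorted lists: the larger head goes first and dominates the other list by
-- transitivity.
merge-shuffle : ∀ {ν c} → Decreasing ν → Decreasing c → ∃[ κ ] (Shuffle κ ν c × Decreasing κ)
merge-shuffle [] [] = [] , [] , []
merge-shuffle (a≥ ∷ dν) [] with merge-shuffle dν []
... | κ , s , d = _ , even _ refl s , All-shuffle⁺ s (All.map even-part-mono-≤ a≥) [] ∷ d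
merge-shuffle [] (b≥ ∷ dc) with merge-shuffle [] dc
... | κ , s , d = _ , odd _ refl s , All-shuffle⁺ s [] (All.map odd-part-mono-≤ b≥) ∷ d
merge-shuffle {a ∷ _} {b ∷ _} (a≥ ∷ dν) (b≥ ∷ dc)
  with ≤-total (2 * suc a) (3 * suc (2 * b)) | merge-shuffle (a≥ ∷ dν) dc | merge-shuffle dν (b≥ ∷ dc)
... | inj₁ e≤o | κ , s , d | _ = _ , odd _ refl s , All-shuffle⁺ s
        (e≤o ∷ All.map (λ le → ≤-trans (even-part-mono-≤ le) e≤o) a≥) (All.map odd-part-mono-≤ b≥) ∷ d
... | inj₂ o≤e | _ | κ , s , d = _ , even _ refl s , All-shuffle⁺ s
        (All.map even-part-mono-≤ a≥) (o≤e ∷ All.map (λ le → ≤-trans (odd-part-mono-≤ le) o≤e) b≥) ∷ d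

shuffle-functional : ∀ {κ ν c ν′ c′} → Shuffle κ ν c → Shuffle κ ν′ c′ → ν ≡ ν′ × c ≡ c′
shuffle-functional [] [] = refl , refl
shuffle-functional (even a refl s) (even b eq t)
  with shuffle-functional s t | *-cancelˡ-≡ (suc a) (suc b) 2 eq
... | refl , refl | refl = refl , refl
shuffle-functional (odd a refl s) (odd b eq t)
  with shuffle-functional s t | *-cancelˡ-≡ a b 2 (suc-injective (*-cancelˡ-≡ (suc (2 * a)) (suc (2 * b)) 3 eq))
... | refl , refl | refl = refl , refl
shuffle-functional (even a refl s) (odd b eq t)  = contradiction eq (even-part≢odd-part a b)
shuffle-functional (odd b refl s)  (even a eq t) = contradiction (sym eq) (even-part≢odd-part a b)

-- ν and `c` do not record how the two kinds of parts interleave; the decreasing order recovers it.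
shuffle-injective : ∀ {κ κ′ ν c} → Decreasing κ → Decreasing κ′ → Shuffle κ ν c → Shuffle κ′ ν c → κ ≡ κ′
shuffle-injective _ _ [] [] = refl
shuffle-injective (_ ∷ d) (_ ∷ d′) (even a refl s) (even .a refl t) = cong (_ ∷_) (shuffle-injective d d′ s t)
shuffle-injective (_ ∷ d) (_ ∷ d′) (odd a refl s)  (odd .a refl t)  = cong (_ ∷_) (shuffle-injective d d′ s t)
-- Each head occurs in the tail of the other list, so the order makes them equal, although one is
-- even and the other odd.
shuffle-injective (p ∷ _) (q ∷ _) (even a refl s) (odd b refl t) = contradiction
  (≤-antisym (All.head (proj₁ (All-shuffle⁻ t q))) (All.head (proj₂ (All-shuffle⁻ s p)))) (even-part≢odd-part a b)
shuffle-injective (p ∷ _) (q ∷ _) (odd b refl s) (even a refl t) = contradiction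
  (≤-antisym (All.head (proj₁ (All-shuffle⁻ s p))) (All.head (proj₂ (All-shuffle⁻ t q)))) (even-part≢odd-part a b)

shuffle-sum : ∀ {κ ν c} → Shuffle κ ν c → sum κ ≡ 2 * size ν + 3 * (sum c + size c)
shuffle-sum [] = refl
shuffle-sum {ν = _ ∷ ν} {c} (even a refl s) = trans (cong (2 * suc a +_) (shuffle-sum s))
  (rearrange a (sum ν) (length ν) (3 * (sum c + size c)))
  where
  rearrange : ∀ a s l t → 2 * suc a + (2 * (s + l) + t) ≡ 2 * (a + s + suc l) + t
  rearrange = solve-∀
shuffle-sum {ν = ν} {_ ∷ c} (odd a refl s) = trans (cong (3 * suc (2 * a) +_) (shuffle-sum s))
  (rearrange a (sum c) (length c) (2 * size ν))
  where
  rearrange : ∀ a s l t → 3 * suc (2 * a) + (t + 3 * (s + (s + l))) ≡ t + 3 * (a + s + (a + s + suc l))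
  rearrange = solve-∀

shuffle-oddParts : ∀ {κ ν c} → Shuffle κ ν c → oddParts κ ≡ length c
shuffle-oddParts [] = refl
shuffle-oddParts (even {κ} a refl s) =
  trans (oddParts-∷ (2 * suc a) κ) (cong₂ _+_ (trans (cong (_% 2) (*-comm 2 (suc a))) (m*n%n≡0 (suc a) 2)) (shuffle-oddParts s))
shuffle-oddParts (odd {κ} a refl s) =
  trans (oddParts-∷ (3 * suc (2 * a)) κ) (cong₂ _+_ odd%2 (shuffle-oddParts s))
  where
  odd%2 : 3 * suc (2 * a) % 2 ≡ 1
  odd%2 = trans (cong (_% 2) (trans (3[1+2a]≡1+2[1+3a] a) (cong suc (*-comm 2 (suc (3 * a)))))) ([m+kn]%n≡m%n 1 (suc (3 * a)) 2)

Residue : ℕ → Set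
Residue p = p % 6 ∈ 0 ∷ 2 ∷ 3 ∷ 4 ∷ []

odd-part-residue : ∀ a → Residue (3 * suc (2 * a))
odd-part-residue a = there (there (here (trans (cong (_% 6) (rearrange a)) ([m+kn]%n≡m%n 3 a 6))))
  where
  rearrange : ∀ a → 3 * suc (2 * a) ≡ 3 + a * 6
  rearrange = solve-∀

-- Raising `a` by three adds 6, so three initial values decide.
even-part-residue : ∀ a → Residue (2 * suc a)
even-part-residue 0 = there (here refl)
even-part-residue 1 = there (there (there (here refl)))
even-part-residue 2 = here refl
even-part-residue (suc (suc (suc a))) = subst (_∈ 0 ∷ 2 ∷ 3 ∷ 4 ∷ [])
  (trans (sym ([m+kn]%n≡m%n (2 * suc a) 1 6)) (cong (_% 6) (rearrange a))) (even-part-residue a)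
  where
  rearrange : ∀ a → 2 * suc a + 1 * 6 ≡ 2 * suc (suc (suc (suc a)))
  rearrange = solve-∀

even⊎odd-part : ∀ p → p > 0 → Residue p → (∃[ a ] p ≡ 2 * suc a) ⊎ (∃[ a ] p ≡ 3 * suc (2 * a))
-- Remainder and quotient are generalised to variables so that the residue can be matched on.
even⊎odd-part p 0<p r = go (p % 6) (p / 6) 0<p r (m≡m%n+[m/n]*n p 6)
  where
  go : ∀ s q → p > 0 → s ∈ 0 ∷ 2 ∷ 3 ∷ 4 ∷ [] → p ≡ s + q * 6 →
       (∃[ a ] p ≡ 2 * suc a) ⊎ (∃[ a ] p ≡ 3 * suc (2 * a))
  -- Remainder 0 with quotient 0 would give `p = 0`; this is where positivity enters.
  go _ zero    0<p (here refl) refl = contradiction 0<p λ ()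
  go _ (suc q) _ (here refl) eq = inj₁ (2 + q * 3 , trans eq (lemma q))
    where
    lemma : ∀ q → suc q * 6 ≡ 2 * suc (2 + q * 3)
    lemma = solve-∀
  go _ q _ (there (here refl)) eq = inj₁ (q * 3 , trans eq (lemma q))
    where
    lemma : ∀ q → 2 + q * 6 ≡ 2 * suc (q * 3)
    lemma = solve-∀
  go _ q _ (there (there (here refl))) eq = inj₂ (q , trans eq (lemma q))
    where
    lemma : ∀ q → 3 + q * 6 ≡ 3 * suc (2 * q)
    lemma = solve-∀
  go _ q _ (there (there (there (here refl)))) eq = inj₁ (1 + q * 3 , trans eq (lemma q))
    where
    lemma : ∀ q → 4 + q * 6 ≡ 2 * suc (1 + q * 3)
    lemma = solve-∀

residues⇒shuffle : ∀ {κ} → All (_> 0) κ → All Residue κ → ∃[ ν ] ∃[ c ] Shuffle κ ν c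
residues⇒shuffle [] _ = [] , [] , []
residues⇒shuffle {p ∷ _} (0<p ∷ ps) (r ∷ rs) with residues⇒shuffle ps rs | even⊎odd-part p 0<p r
... | ν , c , s | inj₁ (a , eq) = a ∷ ν , c , even a eq s
... | ν , c , s | inj₂ (a , eq) = ν , a ∷ c , odd a eq s

-- Composing the three correspondences.

Matches : (κ λs : List ℕ) → Set
Matches κ λs = ∃[ ν ] ∃[ c ] ∃[ δ ] (Shuffle κ ν c × Hooks δ c × Conjugates λs ν δ)

matches-sum : ∀ {κ λs} → Matches κ λs → sum κ ≡ sum λs
matches-sum (ν , c , δ , s , h , r) =
  trans (shuffle-sum s) (trans (cong (λ t → 2 * size ν + 3 * t) (sym (hooks-size h))) (sym (conjugates-sum r)))

matches-oddParts : ∀ {κ λs} → Matches κ λs → oddParts κ ≡ oddParts λs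
matches-oddParts (ν , c , δ , s , h , r) =
  trans (shuffle-oddParts s) (trans (hooks-length h) (sym (conjugates-oddParts r)))

≥-trans : ∀ {i j k : ℕ} → i ≥ j → j ≥ k → i ≥ k
≥-trans p q = ≤-trans q p

congruence⇒gap : ∀ {n m κ} → CongruencePartition n m κ → ∃[ λs ] (GapPartition n m λs × Matches κ λs)
congruence⇒gap π with residues⇒shuffle (IsPartition.positive (CongruencePartition.isPartition π)) (CongruencePartition.residues π)
... | ν , c , s with shuffle-decreasing s (Linked⇒AllPairs ≥-trans (IsPartition.nonIncreasing (CongruencePartition.isPartition π)))
... | dν , dc with hooks-onto dc
... | δ , h with conjugates-total dν (Linked⇒AllPairs (λ p q → <-trans q p) (hooks-linked h))
... | λs , r = λs , record
  { isPartition   = record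
      { nonIncreasing = AllPairs⇒Linked nonIncreasing
      ; positive      = All.map (≤-trans (s≤s z≤n)) parts≥2
      ; sums          = trans (sym (matches-sum M)) (IsPartition.sums (CongruencePartition.isPartition π))
      }
  ; noConsecutive = noConsecutive
  ; parts≥2       = parts≥2
  ; oddCount      = trans (sym (matches-oddParts M)) (CongruencePartition.oddCount π)
  } , M
  where
  M = ν , c , δ , s , h , r
  open Gap (conjugates⇒gap r)

gap⇒congruence : ∀ {n m λs} → GapPartition n m λs → ∃[ κ ] (CongruencePartition n m κ × Matches κ λs)
gap⇒congruence π with gap⇒conjugates (gap (Linked⇒AllPairs ≥-trans (IsPartition.nonIncreasing (GapPartition.isPartition π)))
                                          (GapPartition.parts≥2 π) (GapPartition.noConsecutive π))
... | ν , δ , r with hooks-total (conjugates-strictlyDecreasing r)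
... | c , h with merge-shuffle (conjugates-decreasing r) (hooks-decreasing h)
... | κ , s , d = κ , record
  { isPartition = record
      { nonIncreasing = AllPairs⇒Linked d
      ; positive      = All-shuffle⁺ s (All.universal (λ _ → s≤s z≤n) ν) (All.universal (λ _ → s≤s z≤n) c)
      ; sums          = trans (matches-sum M) (IsPartition.sums (GapPartition.isPartition π))
      }
  ; residues    = All-shuffle⁺ s (All.universal even-part-residue ν) (All.universal odd-part-residue c)
  ; oddCount    = trans (matches-oddParts M) (GapPartition.oddCount π)
  } , M
  where
  M = ν , c , δ , s , h , r

matches-functional : ∀ {κ λs λs′} → Matches κ λs → Matches κ λs′ → λs ≡ λs′
matches-functional (_ , _ , _ , s , h , r) (_ , _ , _ , s′ , h′ , r′) with shuffle-functional s s′
... | refl , refl with hooks-injective h h′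
... | refl = conjugates-injective r r′

matches-injective : ∀ {κ κ′ λs} → Decreasing κ → Decreasing κ′ → Matches κ λs → Matches κ′ λs → κ ≡ κ′
matches-injective d d′ (_ , _ , _ , s , h , r) (_ , _ , _ , s′ , h′ , r′) with conjugates-functional r r′
... | refl , refl with hooks-functional h h′
... | refl = shuffle-injective d d′ s s′

theorem1p3 : (n m : ℕ) →
    ∃[ k ] (NumberOf (GapPartition n m) k × NumberOf (CongruencePartition n m) k)
-- The congruence side is counted by enumeration, and the same `k` is carried over to gap
-- partitions. Order is supplied for injectivity because `Shuffle` alone does not fix it.
theorem1p3 n m with numberOfCongruencePartitions n m
... | k , N = k , numberOf-transfer Matches congruence⇒gap gap⇒congruence
    matches-functional (λ π π′ → matches-injective (decreasing π) (decreasing π′)) N , N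
  where
  decreasing : ∀ {κ} → CongruencePartition n m κ → Decreasing κ
  decreasing π = Linked⇒AllPairs ≥-trans (IsPartition.nonIncreasing (CongruencePartition.isPartition π))
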